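{- A formula $\varphi\in\mathcal{L}$ is valid in all constructive Chellas models if and only if it is derivable in $\mathsf{ConstCK}$.
   Context: $\mathcal{L}$: formulas $\varphi ::= p \mid \bot \mid \varphi\wedge\varphi \mid \varphi\vee\varphi \mid \varphi\to\varphi \mid \varphi \mathbin{\Box\!\!\rightarrow} \varphi \mid \varphi \mathbin{\Diamond\!\!\rightarrow}\varphi$, $p$ from a countable set $Atm$; $\wedge,\vee$ bind more strongly than $\to,\mathbin{\Box\!\!\rightarrow},\mathbin{\Diamond\!\!\rightarrow}$; $\neg\varphi:=\varphi\to\bot$, $\top:=\neg\bot$, $\varphi\leftrightarrow\psi:=(\varphi\to\psi)\wedge(\psi\to\varphi)$. $\mathsf{ConstCK}$: intuitionistic propositional logic in $\mathcal{L}$ with modus ponens, plus axioms CM$_\Box$: $(\varphi\mathbin{\Box\!\!\rightarrow}\psi\wedge\chi)\to(\varphi\mathbin{\Box\!\!\rightarrow}\psi)\wedge(\varphi\mathbin{\Box\!\!\rightarrow}\chi)$; CC$_\Box$: $(\varphi\mathbin{\Box\!\!\rightarrow}\psi)\wedge(\varphi\mathbin{\Box\!\!\rightarrow}\chi)\to(\varphi\mathbin{\Box\!\!\rightarrow}\psi\wedge\chi)$; CN$_\Box$: $\varphi\mathbin{\Box\!\!\rightarrow}\top$; CN$_\Diamond$: $\neg(\varphi\mathbin{\Diamond\!\!\rightarrow}\bot)$; CK$_\Diamond$: $(\varphi\mathbin{\Box\!\!\rightarrow}(\psi\to\chi))\to((\varphi\mathbin{\Diamond\!\!\rightarrow}\psi)\to(\varphi\mathbin{\Diamond\!\!\rightarrow}\chi))$;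 rules RA$_\Box$: from $\varphi\leftrightarrow\rho$ infer $(\varphi\mathbin{\Box\!\!\rightarrow}\psi)\leftrightarrow(\rho\mathbin{\Box\!\!\rightarrow}\psi)$; RC$_\Box$: from $\psi\leftrightarrow\chi$ infer $(\varphi\mathbin{\Box\!\!\rightarrow}\psi)\leftrightarrow(\varphi\mathbin{\Box\!\!\rightarrow}\chi)$; RA$_\Diamond$, RC$_\Diamond$ the same with $\mathbin{\Diamond\!\!\rightarrow}$. A basic model is $M=\langle W,\le,R,V\rangle$: $W\neq\emptyset$; $\le$ a reflexive transitive relation on $W$; $V:W\to 2^{Atm}$ with $w\le w'\Rightarrow V(w)\subseteq V(w')$; $R$ associates to every $X\subseteq W$ a binary relation $R_X$ on $W$. A constructive Chellas model is a basic model with satisfaction: $w\Vdash p$ iff $p\in V(w)$; $w\not\Vdash\bot$; $\wedge,\vee$ pointwise; $w\Vdash\varphi\to\psi$ iff for all $w'\ge w$, $w'\Vdash\varphi$ implies $w'\Vdash\psi$; $w\Vdash\varphi\mathbin{\Box\!\!\rightarrow}\psi$ iff for all $w',v$ with $w\le w'$ and $w'R_{[\![\varphi]\!]}v$, $v\Vdash\psi$; $w\Vdash\varphi\mathbin{\Diamond\!\!\rightarrow}\psi$ iff for all $w'\ge w$ there is $v$ with $w'R_{[\![\varphi]\!]}v$ and $v\Vdash\psi$; where $[\![\varphi]\!]=\{w\in W\mid w\Vdash\varphi\}$. $\varphi$ is valid in $M$ if satisfied at all worlds. -}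

module Defs where

open import Level using (Level; suc; _⊔_; Setω)
open import Data.Nat using (ℕ)
open import Data.Product using (_×_; Σ-syntax)
open import Data.Sum using (_⊎_)
open import Data.Empty.Polymorphic using (⊥)

Atm : Set
Atm = ℕ

infixr 6 _∧_
infixr 6 _∨_
infixr 4 _⇒_ _□→_ _◇→_

data Fml : Set where
  var  : Atm → Fml
  ⊥'   : Fml
  _∧_  : Fml → Fml → Fml
  _∨_  : Fml → Fml → Fml
  _⇒_  : Fml → Fml → Fml
  _□→_ : Fml → Fml → Fml
  _◇→_ : Fml → Fml → Fml

¬' : Fml → Fml
¬' φ = φ ⇒ ⊥'

⊤' : Fml
⊤' = ¬' ⊥'

_⇔_ : Fml → Fml → Fml
φ ⇔ ψ = (φ ⇒ ψ) ∧ (ψ ⇒ φ)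

data ⊢_ : Fml → Set where
  ax-K    : ∀ {φ ψ} → ⊢ (φ ⇒ ψ ⇒ φ)
  ax-S    : ∀ {φ ψ χ} → ⊢ ((φ ⇒ ψ ⇒ χ) ⇒ (φ ⇒ ψ) ⇒ φ ⇒ χ)
  ax-∧I   : ∀ {φ ψ} → ⊢ (φ ⇒ ψ ⇒ φ ∧ ψ)
  ax-∧E₁  : ∀ {φ ψ} → ⊢ (φ ∧ ψ ⇒ φ)
  ax-∧E₂  : ∀ {φ ψ} → ⊢ (φ ∧ ψ ⇒ ψ)
  ax-∨I₁  : ∀ {φ ψ} → ⊢ (φ ⇒ φ ∨ ψ)
  ax-∨I₂  : ∀ {φ ψ} → ⊢ (ψ ⇒ φ ∨ ψ)
  ax-∨E   : ∀ {φ ψ χ} → ⊢ ((φ ⇒ χ) ⇒ (ψ ⇒ χ) ⇒ φ ∨ ψ ⇒ χ)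
  ax-⊥E   : ∀ {φ} → ⊢ (⊥' ⇒ φ)
  mp      : ∀ {φ ψ} → ⊢ (φ ⇒ ψ) → ⊢ φ → ⊢ ψ
  CM□     : ∀ {φ ψ χ} → ⊢ ((φ □→ ψ ∧ χ) ⇒ (φ □→ ψ) ∧ (φ □→ χ))
  CC□     : ∀ {φ ψ χ} → ⊢ ((φ □→ ψ) ∧ (φ □→ χ) ⇒ (φ □→ ψ ∧ χ))
  CN□     : ∀ {φ} → ⊢ (φ □→ ⊤')
  CN◇     : ∀ {φ} → ⊢ ¬' (φ ◇→ ⊥')
  CK◇     : ∀ {φ ψ χ} → ⊢ ((φ □→ (ψ ⇒ χ)) ⇒ (φ ◇→ ψ) ⇒ (φ ◇→ χ))
  RA□     : ∀ {φ ρ ψ} → ⊢ (φ ⇔ ρ) → ⊢ ((φ □→ ψ) ⇔ (ρ □→ ψ))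
  RC□     : ∀ {φ ψ χ} → ⊢ (ψ ⇔ χ) → ⊢ ((φ □→ ψ) ⇔ (φ □→ χ))
  RA◇     : ∀ {φ ρ ψ} → ⊢ (φ ⇔ ρ) → ⊢ ((φ ◇→ ψ) ⇔ (ρ ◇→ ψ))
  RC◇     : ∀ {φ ψ χ} → ⊢ (ψ ⇔ χ) → ⊢ ((φ ◇→ ψ) ⇔ (φ ◇→ χ))

-- Subsets of W are predicates W → Set ℓ; since subsets are extensional,
-- the assignment X ↦ R_X is required to respect extensional equality.
record Model (ℓ : Level) : Set (suc ℓ) where
  field
    W      : Set ℓ
    _≤_    : W → W → Set ℓ
    ≤-refl : ∀ {w} → w ≤ w
    ≤-trans : ∀ {u v w} → u ≤ v → v ≤ w → u ≤ w
    V      : W → Atm → Set ℓ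
    V-mono : ∀ {w w'} → w ≤ w' → ∀ p → V w p → V w' p
    R      : (W → Set ℓ) → W → W → Set ℓ
    R-ext  : ∀ (X Y : W → Set ℓ) → (∀ w → X w → Y w) → (∀ w → Y w → X w)
             → ∀ u v → R X u v → R Y u v

module _ {ℓ : Level} (M : Model ℓ) where
  open Model M

  _⊩_ : W → Fml → Set ℓ
  w ⊩ var p   = V w p
  w ⊩ ⊥'      = ⊥
  w ⊩ (φ ∧ ψ) = (w ⊩ φ) × (w ⊩ ψ)
  w ⊩ (φ ∨ ψ) = (w ⊩ φ) ⊎ (w ⊩ ψ)
  w ⊩ (φ ⇒ ψ) = ∀ w' → w ≤ w' → w' ⊩ φ → w' ⊩ ψ
  w ⊩ (φ □→ ψ) = ∀ w' v → w ≤ w' → R (λ u → u ⊩ φ) w' v → v ⊩ ψ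
  w ⊩ (φ ◇→ ψ) = ∀ w' → w ≤ w' → Σ[ v ∈ W ] (R (λ u → u ⊩ φ) w' v × v ⊩ ψ)

  ValidIn : Fml → Set ℓ
  ValidIn φ = ∀ w → w ⊩ φ

Valid : Fml → Setω
Valid φ = ∀ {ℓ} (M : Model ℓ) → ValidIn M φ

-- Biconditional at Setω (library _⇔_ lives in Set ℓ).
record _⟺_ (A : Setω) (B : Set) : Setω where
  field
    to   : A → B
    from : B → A

{-# OPTIONS --safe #-}
-- Completeness is proved by building a finite countermodel.  Let Σ be the set of
-- subformulas of φ.  Starting from all partitions of Σ into formulas to be forced
-- and formulas not to be forced, repeatedly discard a partition that cannot be
-- realised by means of the remaining ones; each discarded partition T is refutable,
-- pos T ⊢ ⋁ neg T.  If no surviving partition rejects φ, then cuts over Σ give ⊢ φ.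
-- Otherwise the survivors form a model refuting φ.  A world is a survivor T together
-- with one formula α ◇→ χ rejected by T (or the dummy ⊥'), and its ⟦α⟧-successors are
-- required to reject χ: worlds with the same T but different tags witness the failure
-- of the different rejected ◇→-formulas.  Since every alternative arising is
-- "there is a survivor, or there is a derivation", the argument is constructive.
module Submission where

open import Defs
open import Level using (0ℓ; lift; lower)
open import Data.Empty using (⊥; ⊥-elim)
open import Data.List using (List; []; _∷_; _++_; map; foldr; length)
open import Data.List.Membership.Propositional using (_∈_; _∉_)
open import Data.List.Membership.Propositional.Properties using (∈-++⁺ˡ; ∈-++⁺ʳ; ∈-++⁻; ∈-map⁺; ∈-map⁻)
open import Data.List.Relation.Binary.Subset.Propositional using (_⊆_)
open import Data.List.Relation.Unary.Any using (here; there; any?)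
open import Data.Nat using (zero; suc)
open import Data.Nat.Properties using (_≟_; suc-injective)
open import Data.Product using (∃; ∃₂; _×_; _,_; proj₁; proj₂)
open import Data.Sum using (_⊎_; inj₁; inj₂; [_,_]′; map₁; map₂)
open import Data.Unit using (⊤; tt)
open import Function using (_∘_; id)
open import Relation.Binary.PropositionalEquality using (_≡_; refl; sym; trans; cong; subst)
open import Relation.Nullary using (¬_; Dec; yes; no)
open import Relation.Nullary.Decidable using (map′)

-- Soundness

module Soundness {ℓ} (M : Model ℓ) where
  open Model M

  infix 3 _⊨_
  _⊨_ : W → Fml → Set ℓ
  _⊨_ = _⊩_ M

  ⊨-mono : ∀ φ {w w'} → w ≤ w' → w ⊨ φ → w' ⊨ φ
  ⊨-mono (var p)  w≤w' f = V-mono w≤w' p f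
  ⊨-mono (φ ∧ ψ)  w≤w' (f , g) = ⊨-mono φ w≤w' f , ⊨-mono ψ w≤w' g
  ⊨-mono (φ ∨ ψ)  w≤w' (inj₁ f) = inj₁ (⊨-mono φ w≤w' f)
  ⊨-mono (φ ∨ ψ)  w≤w' (inj₂ g) = inj₂ (⊨-mono ψ w≤w' g)
  ⊨-mono (φ ⇒ ψ)  w≤w' f w'' w'≤w'' = f w'' (≤-trans w≤w' w'≤w'')
  ⊨-mono (φ □→ ψ) w≤w' f w'' v w'≤w'' = f w'' v (≤-trans w≤w' w'≤w'')
  ⊨-mono (φ ◇→ ψ) w≤w' f w'' w'≤w'' = f w'' (≤-trans w≤w' w'≤w'')

  -- Valid equivalents have extensionally equal truth sets, so `R-ext` applies; this validates `RA□`
  -- and `RA◇`.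
  R-resp-⇔ : ∀ {φ ρ} → ValidIn M (φ ⇔ ρ) → ∀ {u v} → R (_⊨ φ) u v → R (_⊨ ρ) u v
  R-resp-⇔ eq = R-ext _ _ (λ w → proj₁ (eq w) w ≤-refl) (λ w → proj₂ (eq w) w ≤-refl) _ _

  ⇔-swap : ∀ {φ ρ} → ValidIn M (φ ⇔ ρ) → ValidIn M (ρ ⇔ φ)
  ⇔-swap eq w = proj₂ (eq w) , proj₁ (eq w)

  sound : ∀ {φ} → ⊢ φ → ValidIn M φ
  sound (ax-K {φ}) w w₁ _ f w₂ le _ = ⊨-mono φ le f
  sound ax-S w w₁ _ f w₂ le₂ g w₃ le₃ x =
    f w₃ (≤-trans le₂ le₃) x w₃ ≤-refl (g w₃ le₃ x)
  sound (ax-∧I {φ}) w w₁ _ f w₂ le g = ⊨-mono φ le f , g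
  sound ax-∧E₁ w w₁ _ = proj₁
  sound ax-∧E₂ w w₁ _ = proj₂
  sound ax-∨I₁ w w₁ _ = inj₁
  sound ax-∨I₂ w w₁ _ = inj₂
  sound ax-∨E w w₁ _ f w₂ le₂ g w₃ le₃ (inj₁ x) = f w₃ (≤-trans le₂ le₃) x
  sound ax-∨E w w₁ _ f w₂ le₂ g w₃ le₃ (inj₂ y) = g w₃ le₃ y
  sound ax-⊥E w w₁ _ ()
  sound (mp d e) w = sound d w w ≤-refl (sound e w)
  sound CM□ w w₁ _ f = (λ w' v le r → proj₁ (f w' v le r)) , (λ w' v le r → proj₂ (f w' v le r))
  sound CC□ w w₁ _ (f , g) w' v le r = f w' v le r , g w' v le r
  sound CN□ w w' v _ _ v' _ x = x
  sound CN◇ w w₁ _ f = proj₂ (proj₂ (f w₁ ≤-refl))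
  sound CK◇ w w₁ _ f w₂ le₂ g w₃ le₃ with g w₃ le₃
  ... | v , r , x = v , r , f w₃ v (≤-trans le₂ le₃) r v ≤-refl x
  sound (RA□ {φ} {ρ} d) w =
      (λ w₁ _ f w' v le r → f w' v le (R-resp-⇔ {ρ} {φ} (⇔-swap {φ} {ρ} (sound d)) r))
    , (λ w₁ _ f w' v le r → f w' v le (R-resp-⇔ {φ} {ρ} (sound d) r))
  sound (RC□ d) w =
      (λ w₁ _ f w' v le r → proj₁ (sound d v) v ≤-refl (f w' v le r))
    , (λ w₁ _ f w' v le r → proj₂ (sound d v) v ≤-refl (f w' v le r))
  sound (RA◇ {φ} {ρ} d) w =
      (λ w₁ _ f w' le → let v , r , x = f w' le in v , R-resp-⇔ {φ} {ρ} (sound d) r , x)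
    , (λ w₁ _ f w' le → let v , r , x = f w' le in
         v , R-resp-⇔ {ρ} {φ} (⇔-swap {φ} {ρ} (sound d)) r , x)
  sound (RC◇ d) w =
      (λ w₁ _ f w' le → let v , r , x = f w' le in v , r , proj₁ (sound d v) v ≤-refl x)
    , (λ w₁ _ f w' le → let v , r , x = f w' le in v , r , proj₂ (sound d v) v ≤-refl x)

-- Derivations from hypotheses

infix 3 _⊢ᶜ_

-- Hypotheses pass only through modus ponens; the congruence rules act inside `thm`, on theorems
-- alone, which is what keeps the deduction theorem available.
data _⊢ᶜ_ (Γ : List Fml) : Fml → Set where
  thm : ∀ {a} → ⊢ a → Γ ⊢ᶜ a
  hyp : ∀ {a} → a ∈ Γ → Γ ⊢ᶜ a
  app : ∀ {a b} → Γ ⊢ᶜ (a ⇒ b) → Γ ⊢ᶜ a → Γ ⊢ᶜ b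

private variable
  Γ Δ Δ' : List Fml
  a b c x : Fml

weaken : Γ ⊆ Δ → Γ ⊢ᶜ a → Δ ⊢ᶜ a
weaken s (thm d)   = thm d
weaken s (hyp i)   = hyp (s i)
weaken s (app d e) = app (weaken s d) (weaken s e)

deduction : x ∷ Γ ⊢ᶜ a → Γ ⊢ᶜ (x ⇒ a)
deduction (thm d)          = thm (mp ax-K d)
-- The combinator identity SKK; the goal leaves the formula `ψ` of the second `ax-K` open, so it is
-- set to `x`.
deduction {x} (hyp (here refl)) = thm (mp (mp ax-S ax-K) (ax-K {ψ = x}))
deduction (hyp (there i))  = app (thm ax-K) (hyp i)
deduction (app d e)        = app (app (thm ax-S) (deduction d)) (deduction e)

closed-⊢ : [] ⊢ᶜ a → ⊢ a
closed-⊢ (thm d)   = d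
closed-⊢ (app d e) = mp (closed-⊢ d) (closed-⊢ e)

⇔-intro : [] ⊢ᶜ (a ⇒ b) → [] ⊢ᶜ (b ⇒ a) → ⊢ (a ⇔ b)
⇔-intro d e = mp (mp ax-∧I (closed-⊢ d)) (closed-⊢ e)

⇔-to : ⊢ (a ⇔ b) → Γ ⊢ᶜ a → Γ ⊢ᶜ b
⇔-to d = app (thm (mp ax-∧E₁ d))

⇔-from : ⊢ (a ⇔ b) → Γ ⊢ᶜ b → Γ ⊢ᶜ a
⇔-from d = app (thm (mp ax-∧E₂ d))

⋁ : List Fml → Fml
⋁ = foldr _∨_ ⊥'

⋁-intro : x ∈ Δ → Γ ⊢ᶜ x → Γ ⊢ᶜ ⋁ Δ
⋁-intro (here refl) d = app (thm ax-∨I₁) d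
⋁-intro (there i)   d = app (thm ax-∨I₂) (⋁-intro i d)

∨-elim : Γ ⊢ᶜ (a ∨ b) → a ∷ Γ ⊢ᶜ c → b ∷ Γ ⊢ᶜ c → Γ ⊢ᶜ c
∨-elim d e f = app (app (app (thm ax-∨E) (deduction e)) (deduction f)) d

⋁-mono : Δ ⊆ Δ' → Γ ⊢ᶜ ⋁ Δ → Γ ⊢ᶜ ⋁ Δ'
⋁-mono {[]}    s d = app (thm ax-⊥E) d
⋁-mono {x ∷ Δ} s d =
  ∨-elim d (⋁-intro (s (here refl)) (hyp (here refl))) (⋁-mono (s ∘ there) (hyp (here refl)))

⋁-singleton : Γ ⊢ᶜ ⋁ (x ∷ []) → Γ ⊢ᶜ x
⋁-singleton d = ∨-elim d (hyp (here refl)) (app (thm ax-⊥E) (hyp (here refl)))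

cut : x ∷ Γ ⊢ᶜ ⋁ Δ → Γ ⊢ᶜ ⋁ (x ∷ Δ) → Γ ⊢ᶜ ⋁ Δ
cut d e = ∨-elim e d (hyp (here refl))

-- The calculus offers congruence in the consequent rather than monotonicity. Here `a` is equivalent
-- to `a ∧ b`, and `CM□` splits off `b`.
□→-mono : [] ⊢ᶜ (a ⇒ b) → Γ ⊢ᶜ (c □→ a) → Γ ⊢ᶜ (c □→ b)
□→-mono {a} {b} d e = app (thm ax-∧E₂) (app (thm CM□) (⇔-to (RC□ a⇔a∧b) e))
  where
  a⇔a∧b : ⊢ (a ⇔ (a ∧ b))
  a⇔a∧b = ⇔-intro
    (deduction (app (app (thm ax-∧I) (hyp (here refl))) (app (weaken (λ ()) d) (hyp (here refl)))))
    (thm ax-∧E₁)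

-- Induction on the derivation from `Δ`: `CN□` handles theorems and `CC□` handles modus ponens.
□→-closed : (∀ {x} → x ∈ Δ → Γ ⊢ᶜ (c □→ x)) → Δ ⊢ᶜ a → Γ ⊢ᶜ (c □→ a)
□→-closed f (thm d)   = □→-mono (thm (mp ax-K d)) (thm CN□)
□→-closed f (hyp i)   = f i
□→-closed f (app d e) =
  □→-mono (deduction (app (app (thm ax-∧E₁) (hyp (here refl))) (app (thm ax-∧E₂) (hyp (here refl)))))
    (app (thm CC□) (app (app (thm ax-∧I) (□→-closed f d)) (□→-closed f e)))

-- Pruning a finite set

private variable
  A : Set
  P Q : A → Set

all-or : {B : Set} (xs : List A) → (∀ {x} → x ∈ xs → P x ⊎ B) → (∀ {x} → x ∈ xs → P x) ⊎ B
all-or []       f = inj₁ λ ()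
all-or (x ∷ xs) f with f (here refl) | all-or xs (f ∘ there)
... | inj₂ q | _      = inj₂ q
... | _      | inj₂ q = inj₂ q
... | inj₁ p | inj₁ g = inj₁ λ { (here refl) → p ; (there i) → g i }

remove-one : (xs : List A) → (∀ {x} → x ∈ xs → P x ⊎ Q x) →
  (∀ {x} → x ∈ xs → P x) ⊎
  (∃ λ ys → suc (length ys) ≡ length xs × ys ⊆ xs × (∀ {x} → x ∈ xs → x ∈ ys ⊎ Q x))
remove-one []       f = inj₁ λ ()
remove-one (x ∷ xs) f with f (here refl) | remove-one xs (f ∘ there)
... | inj₂ q | _ = inj₂ (xs , refl , there , λ { (here refl) → inj₂ q ; (there i) → inj₁ i })
... | inj₁ p | inj₁ g = inj₁ λ { (here refl) → p ; (there i) → g i }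
... | inj₁ p | inj₂ (ys , len , sub , keep) =
  inj₂ (x ∷ ys , cong suc len
       , (λ { (here refl) → here refl ; (there i) → there (sub i) })
       , (λ { (here refl) → inj₁ (here refl) ; (there i) → map₁ there (keep i) }))

module Pruning {A : Set} (U : List A) (Bad : A → Set) (Good : List A → A → Set) where

  AllButBad : List A → Set
  AllButBad S = ∀ {x} → x ∈ U → x ∈ S ⊎ Bad x

  -- Each failed round shortens the list by one, so its length bounds the rounds. `Bad` does not
  -- mention the list, so a discarded element stays justified, while `Good` is tested afresh each
  -- time.
  prune : (∀ S → AllButBad S → ∀ {x} → x ∈ U → Good S x ⊎ Bad x) →
          ∃ λ S → AllButBad S × (∀ {x} → x ∈ S → Good S x)
  prune step = go (length U) U refl id inj₁
    where
    go : ∀ n S → length S ≡ n → S ⊆ U → AllButBad S →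
         ∃ λ S → AllButBad S × (∀ {x} → x ∈ S → Good S x)
    go n S len S⊆U inv with remove-one S (λ i → step S inv (S⊆U i))
    go n       S len S⊆U inv | inj₁ good = S , inv , good
    go zero    S len S⊆U inv | inj₂ (S' , len' , _) with () ← trans len' len
    go (suc n) S len S⊆U inv | inj₂ (S' , len' , S'⊆S , keep) =
      go n S' (suc-injective (trans len' len)) (S⊆U ∘ S'⊆S)
        (λ i → [ keep , inj₂ ]′ (inv i))

-- Subformulas

children : Fml → List Fml
children (var _)  = []
children ⊥'       = []
children (a ∧ b)  = a ∷ b ∷ []
children (a ∨ b)  = a ∷ b ∷ []
children (a ⇒ b)  = a ∷ b ∷ []
children (a □→ b) = a ∷ b ∷ []
children (a ◇→ b) = a ∷ b ∷ []

Closed : List Fml → Set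
Closed xs = ∀ {x y} → x ∈ xs → y ∈ children x → y ∈ xs

subformulas : Fml → List Fml
subformulas φ@(var _)  = φ ∷ []
subformulas φ@⊥'       = φ ∷ []
subformulas φ@(a ∧ b)  = φ ∷ subformulas a ++ subformulas b
subformulas φ@(a ∨ b)  = φ ∷ subformulas a ++ subformulas b
subformulas φ@(a ⇒ b)  = φ ∷ subformulas a ++ subformulas b
subformulas φ@(a □→ b) = φ ∷ subformulas a ++ subformulas b
subformulas φ@(a ◇→ b) = φ ∷ subformulas a ++ subformulas b

self∈subformulas : ∀ φ → φ ∈ subformulas φ
self∈subformulas (var _)  = here refl
self∈subformulas ⊥'       = here refl
self∈subformulas (_ ∧ _)  = here refl
self∈subformulas (_ ∨ _)  = here refl
self∈subformulas (_ ⇒ _)  = here refl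
self∈subformulas (_ □→ _) = here refl
self∈subformulas (_ ◇→ _) = here refl

closed-node : ∀ φ a b → children φ ≡ a ∷ b ∷ [] →
  Closed (subformulas a) → Closed (subformulas b) →
  Closed (φ ∷ subformulas a ++ subformulas b)
closed-node φ a b eq ca cb (here refl) j with subst (_ ∈_) eq j
... | here refl         = there (∈-++⁺ˡ (self∈subformulas a))
... | there (here refl) = there (∈-++⁺ʳ (subformulas a) (self∈subformulas b))
closed-node φ a b eq ca cb (there i) j with ∈-++⁻ (subformulas a) i
... | inj₁ k = there (∈-++⁺ˡ (ca k j))
... | inj₂ k = there (∈-++⁺ʳ (subformulas a) (cb k j))

subformulas-closed : ∀ φ → Closed (subformulas φ)
subformulas-closed (var _) (here refl) ()
subformulas-closed ⊥'      (here refl) ()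
subformulas-closed φ@(a ∧ b)  = closed-node φ a b refl (subformulas-closed a) (subformulas-closed b)
subformulas-closed φ@(a ∨ b)  = closed-node φ a b refl (subformulas-closed a) (subformulas-closed b)
subformulas-closed φ@(a ⇒ b)  = closed-node φ a b refl (subformulas-closed a) (subformulas-closed b)
subformulas-closed φ@(a □→ b) = closed-node φ a b refl (subformulas-closed a) (subformulas-closed b)
subformulas-closed φ@(a ◇→ b) = closed-node φ a b refl (subformulas-closed a) (subformulas-closed b)

-- Serves to test whether a rejected variable is also accepted.
var≟ : ∀ p x → Dec (var p ≡ x)
var≟ p (var q)  = map′ (cong var) (λ { refl → refl }) (p ≟ q)
var≟ p ⊥'       = no λ ()
var≟ p (_ ∧ _)  = no λ ()
var≟ p (_ ∨ _)  = no λ ()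
var≟ p (_ ⇒ _)  = no λ ()
var≟ p (_ □→ _) = no λ ()
var≟ p (_ ◇→ _) = no λ ()

is-□→? : ∀ x → Dec (∃₂ λ a b → x ≡ (a □→ b))
is-□→? (var _)  = no λ ()
is-□→? ⊥'       = no λ ()
is-□→? (_ ∧ _)  = no λ ()
is-□→? (_ ∨ _)  = no λ ()
is-□→? (_ ⇒ _)  = no λ ()
is-□→? (a □→ b) = yes (a , b , refl)
is-□→? (_ ◇→ _) = no λ ()

is-◇→? : ∀ x → Dec (∃₂ λ a b → x ≡ (a ◇→ b))
is-◇→? (var _)  = no λ ()
is-◇→? ⊥'       = no λ ()
is-◇→? (_ ∧ _)  = no λ ()
is-◇→? (_ ∨ _)  = no λ ()
is-◇→? (_ ⇒ _)  = no λ ()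
is-◇→? (_ □→ _) = no λ ()
is-◇→? (a ◇→ b) = yes (a , b , refl)

-- Partitions

-- pos and neg may overlap when the partitioned list has repetitions.
record Partition : Set where
  constructor _∣_
  field
    pos neg : List Fml
open Partition

Refuted : Partition → Set
Refuted T = pos T ⊢ᶜ ⋁ (neg T)

accept reject : Fml → Partition → Partition
accept x (Γ ∣ Δ) = (x ∷ Γ) ∣ Δ
reject x (Γ ∣ Δ) = Γ ∣ (x ∷ Δ)

partitions : List Fml → List Partition
partitions []       = ([] ∣ []) ∷ []
partitions (x ∷ xs) = map (accept x) (partitions xs) ++ map (reject x) (partitions xs)

accept∈ : ∀ {xs T} → T ∈ partitions xs → accept x T ∈ partitions (x ∷ xs)
accept∈ i = ∈-++⁺ˡ (∈-map⁺ _ i)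

reject∈ : ∀ {xs T} → T ∈ partitions xs → reject x T ∈ partitions (x ∷ xs)
reject∈ {x} {xs} i = ∈-++⁺ʳ (map (accept x) (partitions xs)) (∈-map⁺ _ i)

covers : ∀ xs {T} → T ∈ partitions xs → x ∈ xs → x ∈ pos T ⊎ x ∈ neg T
covers (z ∷ xs) i j with ∈-++⁻ (map (accept z) (partitions xs)) i
covers (z ∷ xs) i j | inj₁ k with ∈-map⁻ (accept z) k
covers (z ∷ xs) i (here refl) | inj₁ k | T , l , refl = inj₁ (here refl)
covers (z ∷ xs) i (there j)   | inj₁ k | T , l , refl = map₁ there (covers xs l j)
covers (z ∷ xs) i j | inj₂ k with ∈-map⁻ (reject z) k
covers (z ∷ xs) i (here refl) | inj₂ k | T , l , refl = inj₂ (here refl)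
covers (z ∷ xs) i (there j)   | inj₂ k | T , l , refl = map₂ there (covers xs l j)

within : ∀ xs {T} → T ∈ partitions xs → pos T ⊆ xs × neg T ⊆ xs
within [] (here refl) = (λ ()) , (λ ())
within (z ∷ xs) i with ∈-++⁻ (map (accept z) (partitions xs)) i
... | inj₁ k with ∈-map⁻ (accept z) k
...   | T , l , refl = (λ { (here refl) → here refl ; (there j) → there (proj₁ (within xs l) j) })
                     , there ∘ proj₂ (within xs l)
within (z ∷ xs) i | inj₂ k with ∈-map⁻ (reject z) k
...   | T , l , refl = there ∘ proj₁ (within xs l)
                     , (λ { (here refl) → here refl ; (there j) → there (proj₂ (within xs l) j) })

-- A cut on the head formula merges its accepting and rejecting branches; `B` carries along the
-- other outcome, a suitable survivor met in some branch.
cut-all : {B : Set} → ∀ xs →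
  (∀ {T} → T ∈ partitions xs → B ⊎ (pos T ++ Γ ⊢ᶜ ⋁ (neg T ++ Δ))) → B ⊎ (Γ ⊢ᶜ ⋁ Δ)
cut-all []       f = f (here refl)
cut-all {Γ} {Δ} {B} (x ∷ xs) f = cut-all xs combine
  where
  combine : ∀ {T} → T ∈ partitions xs → B ⊎ (pos T ++ Γ ⊢ᶜ ⋁ (neg T ++ Δ))
  combine {T} i with f (accept∈ {xs = xs} i) | f (reject∈ {xs = xs} i)
  ... | inj₁ s | _      = inj₁ s
  ... | _      | inj₁ s = inj₁ s
  ... | inj₂ d | inj₂ e = inj₂ (cut {Δ = neg T ++ Δ} d e)

-- E α means that α denotes the proposition indexing the accessibility relation.
Successor : (E : Fml → Set) → Partition → Fml → Partition → Set
Successor E T x T' =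
    (∀ {α χ} → (α □→ χ) ∈ pos T → E α → χ ∈ pos T')
  × (∀ {α χ} → x ≡ (α ◇→ χ) → E α → χ ∈ neg T')

successor-antitone : ∀ {E E' : Fml → Set} T {T'} → (∀ {α} → E' α → E α) →
  Successor E T x T' → Successor E' T x T'
successor-antitone T f (g , h) = (λ i e → g i (f e)) , (λ eq e → h eq (f e))

-- A stand-in for equality of truth sets, phrased through `S` alone because the model does not exist
-- yet.
Equivalent : List Partition → Fml → Fml → Set
Equivalent S a b = ∀ {T} → T ∈ S → ¬ (a ∈ pos T × b ∈ neg T) × ¬ (b ∈ pos T × a ∈ neg T)

-- The `◇→` clause asks for one witness per tag, since every tagged copy of `T` needs its own
-- successor. Accepted `□→` formulas are already enforced by `Successor`.
Realised⁺ : List Partition → Partition → Fml → Set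
Realised⁺ S T (var p)  = ⊤
Realised⁺ S T ⊥'       = ⊥
Realised⁺ S T (a ∧ b)  = a ∈ pos T × b ∈ pos T
Realised⁺ S T (a ∨ b)  = a ∈ pos T ⊎ b ∈ pos T
Realised⁺ S T (a ⇒ b)  = a ∈ neg T ⊎ b ∈ pos T
Realised⁺ S T (a □→ b) = ⊤
Realised⁺ S T (a ◇→ b) = ∀ {x} → x ∈ ⊥' ∷ neg T →
  ∃ λ T' → T' ∈ S × Successor (Equivalent S a) T x T' × b ∈ pos T'

-- A rejected `◇→` asks nothing of `S`, as the copy of `T` tagged with it will witness the failure.
-- For `□→` the untagged copy serves, hence the tag `⊥'`.
Realised⁻ : List Partition → Partition → Fml → Set
Realised⁻ S T (var p)  = var p ∉ pos T
Realised⁻ S T ⊥'       = ⊤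
Realised⁻ S T (a ∧ b)  = a ∈ neg T ⊎ b ∈ neg T
Realised⁻ S T (a ∨ b)  = a ∈ neg T × b ∈ neg T
Realised⁻ S T (a ⇒ b)  = ∃ λ T' → T' ∈ S × pos T ⊆ pos T' × a ∈ pos T' × b ∈ neg T'
Realised⁻ S T (a □→ b) = ∃ λ T' → T' ∈ S × Successor (Equivalent S a) T ⊥' T' × b ∈ neg T'
Realised⁻ S T (a ◇→ b) = ⊤

Realised : List Partition → Partition → Set
Realised S T = (∀ {x} → x ∈ pos T → Realised⁺ S T x) × (∀ {x} → x ∈ neg T → Realised⁻ S T x)

-- Every partition is realised by the remaining ones or refuted

module Elimination (Sub : List Fml) (closed : Closed Sub) (⊥∈Sub : ⊥' ∈ Sub) where

  open Pruning (partitions Sub) Refuted Realised public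

  module _ {S : List Partition} (inv : AllButBad S) where

    -- A discarded partition is refuted; a remaining one either extends `Γ` and `Δ` or puts one of
    -- their formulas on the opposite side, which closes its branch at once. If no branch extends
    -- them, cuts over `Sub` give the derivation.
    lindenbaum : ∀ Γ Δ → Γ ⊆ Sub → Δ ⊆ Sub →
      (∃ λ T → T ∈ S × Γ ⊆ pos T × Δ ⊆ neg T) ⊎ (Γ ⊢ᶜ ⋁ Δ)
    lindenbaum Γ Δ Γ⊆ Δ⊆ = cut-all Sub branch
      where
      branch : ∀ {T} → T ∈ partitions Sub →
        (∃ λ T → T ∈ S × Γ ⊆ pos T × Δ ⊆ neg T) ⊎ (pos T ++ Γ ⊢ᶜ ⋁ (neg T ++ Δ))
      branch {T} i with inv i
      ... | inj₂ d = inj₂ (⋁-mono {neg T} {neg T ++ Δ} ∈-++⁺ˡ (weaken ∈-++⁺ˡ d))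
      ... | inj₁ T∈S with all-or Γ Γ-placed | all-or Δ Δ-placed
        where
        Γ-placed : ∀ {x} → x ∈ Γ → x ∈ pos T ⊎ (pos T ++ Γ ⊢ᶜ ⋁ (neg T ++ Δ))
        Γ-placed j with covers Sub i (Γ⊆ j)
        ... | inj₁ k = inj₁ k
        ... | inj₂ k = inj₂ (⋁-intro (∈-++⁺ˡ k) (hyp (∈-++⁺ʳ (pos T) j)))
        Δ-placed : ∀ {x} → x ∈ Δ → x ∈ neg T ⊎ (pos T ++ Γ ⊢ᶜ ⋁ (neg T ++ Δ))
        Δ-placed j with covers Sub i (Δ⊆ j)
        ... | inj₁ k = inj₂ (⋁-intro (∈-++⁺ʳ (neg T) j) (hyp (∈-++⁺ˡ k)))
        ... | inj₂ k = inj₁ k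
      ...   | inj₂ d | _      = inj₂ d
      ...   | _      | inj₂ d = inj₂ d
      ...   | inj₁ f | inj₁ g = inj₁ (T , T∈S , f , g)

    separate : a ∈ Sub → b ∈ Sub →
      (∃ λ T → T ∈ S × a ∈ pos T × b ∈ neg T) ⊎ ([] ⊢ᶜ (a ⇒ b))
    separate {a} {b} i j
      with lindenbaum (a ∷ []) (b ∷ []) (λ { (here refl) → i }) (λ { (here refl) → j })
    ... | inj₁ (T , k , f , g) = inj₁ (T , k , f (here refl) , g (here refl))
    ... | inj₂ d = inj₂ (deduction (⋁-singleton d))

    -- When no survivor separates the two formulas, both implications are derivable, and `RA□` and
    -- `RA◇` may exchange them as antecedents.
    equivalent-or-not : a ∈ Sub → b ∈ Sub → ¬ Equivalent S a b ⊎ ⊢ (a ⇔ b)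
    equivalent-or-not i j with separate i j | separate j i
    ... | inj₁ (T , k , f , g) | _ = inj₁ λ e → proj₁ (e k) (f , g)
    ... | _ | inj₁ (T , k , f , g) = inj₁ λ e → proj₂ (e k) (f , g)
    ... | inj₂ d | inj₂ e = inj₂ (⇔-intro d e)

    -- `Γ` gathers what `L` forces on an `a`-successor. Its first property yields the `□→` half of
    -- `Successor`; its second lets `□→-closed` pull a failed extension back to `L`.
    □-consequents : a ∈ Sub → ∀ L → L ⊆ Sub → ∃ λ Γ →
        (∀ {α χ} → (α □→ χ) ∈ L → Equivalent S a α → χ ∈ Γ)
      × (∀ {χ} → χ ∈ Γ → χ ∈ Sub × (L ⊢ᶜ (a □→ χ)))
    □-consequents i [] L⊆ = [] , (λ ()) , (λ ())
    □-consequents {a} i (x ∷ L) L⊆ with □-consequents i L (L⊆ ∘ there) | is-□→? x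
    ... | Γ , complete , correct | no ¬□ =
      Γ , (λ { (here eq) → ⊥-elim (¬□ (_ , _ , sym eq)) ; (there j) → complete j })
        , (λ j → proj₁ (correct j) , weaken there (proj₂ (correct j)))
    ... | Γ , complete , correct | yes (α , χ , refl)
      with equivalent-or-not i (closed (L⊆ (here refl)) (here refl))
    ...   | inj₁ ¬eqv =
      Γ , (λ { (here refl) e → ⊥-elim (¬eqv e) ; (there j) → complete j })
        , (λ j → proj₁ (correct j) , weaken there (proj₂ (correct j)))
    ...   | inj₂ a⇔α =
      χ ∷ Γ
        , (λ { (here refl) _ → here refl ; (there j) e → there (complete j e) })
        , (λ { (here refl) → closed (L⊆ (here refl)) (there (here refl))
                           , ⇔-from (RA□ a⇔α) (hyp (here refl))
             ; (there j) → proj₁ (correct j) , weaken there (proj₂ (correct j)) })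

    module _ {T : Partition} (T∈ : T ∈ partitions Sub) where

      pos⊆ : pos T ⊆ Sub
      pos⊆ = proj₁ (within Sub T∈)

      neg⊆ : neg T ⊆ Sub
      neg⊆ = proj₂ (within Sub T∈)

      refute : x ∈ ⊥' ∷ neg T → pos T ⊢ᶜ x → Refuted T
      refute (here refl) d = app (thm ax-⊥E) d
      refute (there i)   d = ⋁-intro i d

      place : x ∈ Sub → x ∈ pos T ⊎ x ∈ neg T
      place = covers Sub T∈

      -- A formula that every a-successor of T tagged with x must reject; ⊥' when
      -- the tag imposes nothing.
      ◇-target : a ∈ Sub → x ∈ ⊥' ∷ neg T → ∃ λ d → d ∈ Sub
        × (∀ {α χ} → x ≡ (α ◇→ χ) → Equivalent S a α → d ≡ χ)
        × (pos T ⊢ᶜ (a ◇→ d) → Refuted T)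
      ◇-target {a} {x} i j with is-◇→? x
      ... | no ¬◇ = ⊥' , ⊥∈Sub , (λ eq _ → ⊥-elim (¬◇ (_ , _ , eq)))
                  , (λ d → app (thm ax-⊥E) (app (thm CN◇) d))
      ◇-target i (there j) | yes (α , χ , refl)
        with equivalent-or-not i (closed (neg⊆ j) (here refl))
      ... | inj₁ ¬eqv = ⊥' , ⊥∈Sub , (λ { refl e → ⊥-elim (¬eqv e) })
                      , (λ d → app (thm ax-⊥E) (app (thm CN◇) d))
      ... | inj₂ a⇔α = χ , closed (neg⊆ j) (there (here refl)) , (λ { refl _ → refl })
                     , (λ d → ⋁-intro j (⇔-to (RA◇ a⇔α) d))

      realise⁺ : x ∈ pos T → Realised⁺ S T x ⊎ Refuted T
      realise⁺ {var p}  i = inj₁ tt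
      realise⁺ {⊥'}     i = inj₂ (app (thm ax-⊥E) (hyp i))
      realise⁺ {a ∧ b}  i with place (closed (pos⊆ i) (here refl)) | place (closed (pos⊆ i) (there (here refl)))
      ... | inj₁ j | inj₁ k = inj₁ (j , k)
      ... | inj₂ j | _      = inj₂ (⋁-intro j (app (thm ax-∧E₁) (hyp i)))
      ... | _      | inj₂ k = inj₂ (⋁-intro k (app (thm ax-∧E₂) (hyp i)))
      realise⁺ {a ∨ b}  i with place (closed (pos⊆ i) (here refl)) | place (closed (pos⊆ i) (there (here refl)))
      ... | inj₁ j | _      = inj₁ (inj₁ j)
      ... | _      | inj₁ k = inj₁ (inj₂ k)
      ... | inj₂ j | inj₂ k =
        inj₂ (∨-elim (hyp i) (⋁-intro j (hyp (here refl))) (⋁-intro k (hyp (here refl))))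
      realise⁺ {a ⇒ b}  i with place (closed (pos⊆ i) (here refl)) | place (closed (pos⊆ i) (there (here refl)))
      ... | inj₂ j | _      = inj₁ (inj₁ j)
      ... | _      | inj₁ k = inj₁ (inj₂ k)
      ... | inj₁ j | inj₂ k = inj₂ (⋁-intro k (app (hyp i) (hyp j)))
      realise⁺ {a □→ b} i = inj₁ tt
      realise⁺ {a ◇→ b} i = all-or (⊥' ∷ neg T) witness
        where
        a∈ : a ∈ Sub
        a∈ = closed (pos⊆ i) (here refl)
        b∈ : b ∈ Sub
        b∈ = closed (pos⊆ i) (there (here refl))
        witness : ∀ {x} → x ∈ ⊥' ∷ neg T →
          (∃ λ T' → T' ∈ S × Successor (Equivalent S a) T x T' × b ∈ pos T') ⊎ Refuted T
        witness j with □-consequents a∈ (pos T) pos⊆ | ◇-target a∈ j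
        ... | Γ , complete , correct | d , d∈ , target , refuting
          -- A survivor here is the required witness. Otherwise `Γ` derives `b ⇒ d`, so `pos T`
          -- derives `a □→ (b ⇒ d)`, and `CK◇` turns `a ◇→ b` into the refuting `a ◇→ d`.
          with lindenbaum (b ∷ Γ) (d ∷ []) (λ { (here refl) → b∈ ; (there k) → proj₁ (correct k) })
                          (λ { (here refl) → d∈ })
        ...   | inj₁ (T' , T'∈ , f , g) =
          inj₁ (T' , T'∈
               , ((λ k e → f (there (complete k e)))
                 , (λ eq e → subst (_∈ neg T') (target eq e) (g (here refl))))
               , f (here refl))
        ...   | inj₂ D =
          inj₂ (refuting (app (app (thm CK◇)
            (□→-closed (proj₂ ∘ correct) (deduction (⋁-singleton D)))) (hyp i)))

      realise⁻ : x ∈ neg T → Realised⁻ S T x ⊎ Refuted T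
      realise⁻ {var p}  i with any? (var≟ p) (pos T)
      ... | yes j = inj₂ (⋁-intro i (hyp j))
      ... | no ¬j = inj₁ ¬j
      realise⁻ {⊥'}     i = inj₁ tt
      realise⁻ {a ∧ b}  i with place (closed (neg⊆ i) (here refl)) | place (closed (neg⊆ i) (there (here refl)))
      ... | inj₂ j | _      = inj₁ (inj₁ j)
      ... | _      | inj₂ k = inj₁ (inj₂ k)
      ... | inj₁ j | inj₁ k = inj₂ (⋁-intro i (app (app (thm ax-∧I) (hyp j)) (hyp k)))
      realise⁻ {a ∨ b}  i with place (closed (neg⊆ i) (here refl)) | place (closed (neg⊆ i) (there (here refl)))
      ... | inj₂ j | inj₂ k = inj₁ (j , k)
      ... | inj₁ j | _      = inj₂ (⋁-intro i (app (thm ax-∨I₁) (hyp j)))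
      ... | _      | inj₁ k = inj₂ (⋁-intro i (app (thm ax-∨I₂) (hyp k)))
      realise⁻ {a ⇒ b}  i
        with lindenbaum (a ∷ pos T) (b ∷ [])
               (λ { (here refl) → closed (neg⊆ i) (here refl) ; (there k) → pos⊆ k })
               (λ { (here refl) → closed (neg⊆ i) (there (here refl)) })
      ... | inj₁ (T' , T'∈ , f , g) = inj₁ (T' , T'∈ , f ∘ there , f (here refl) , g (here refl))
      ... | inj₂ D = inj₂ (⋁-intro i (deduction (⋁-singleton D)))
      realise⁻ {a □→ b} i with □-consequents (closed (neg⊆ i) (here refl)) (pos T) pos⊆
      ... | Γ , complete , correct
        with lindenbaum Γ (b ∷ []) (proj₁ ∘ correct)
               (λ { (here refl) → closed (neg⊆ i) (there (here refl)) })
      ...   | inj₁ (T' , T'∈ , f , g) =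
        -- The dummy tag is no `◇→` formula, so the second half of `Successor` is vacuous.
        inj₁ (T' , T'∈ , ((λ k e → f (complete k e)) , (λ ())) , g (here refl))
      ...   | inj₂ D = inj₂ (⋁-intro i (□→-closed (proj₂ ∘ correct) (⋁-singleton D)))
      realise⁻ {a ◇→ b} i = inj₁ tt

      realise : Realised S T ⊎ Refuted T
      realise with all-or (pos T) realise⁺ | all-or (neg T) realise⁻
      ... | inj₂ d | _      = inj₂ d
      ... | _      | inj₂ d = inj₂ d
      ... | inj₁ f | inj₁ g = inj₁ (f , g)

  survivors : ∃ λ S → AllButBad S × (∀ {T} → T ∈ S → Realised S T)
  survivors = prune λ S inv → realise inv

-- The countermodel

module Countermodel (S : List Partition) (realised : ∀ {T} → T ∈ S → Realised S T) where

  record World : Set where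
    constructor world
    field
      {part} : Partition
      part∈  : part ∈ S
      {tag}  : Fml
      tag∈   : tag ∈ ⊥' ∷ neg part
  open World

  untagged : ∀ {T} → T ∈ S → World
  untagged T∈ = world T∈ (here refl)

  -- Defined for arbitrary `X`, as the model must interpret every subset; where no formula denotes
  -- `X`, the relation becomes total.
  Denotes : (World → Set) → Fml → Set
  Denotes X a = ∀ w → (a ∈ pos (part w) → X w) × (a ∈ neg (part w) → ¬ X w)

  -- A survivor separating the formulas would put its untagged world both inside and outside `X`.
  -- Hence successors found during elimination remain successors in the model.
  denotes-same : ∀ {X} → Denotes X a → Denotes X b → Equivalent S a b
  denotes-same f g T∈ =
      (λ (i , j) → proj₂ (g (untagged T∈)) j (proj₁ (f (untagged T∈)) i))
    , (λ (i , j) → proj₂ (f (untagged T∈)) j (proj₁ (g (untagged T∈)) i))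

  model : Model 0ℓ
  model = record
    { W       = World
    -- The order ignores tags, so a world sees every copy of its own partition.
    ; _≤_     = λ w w' → pos (part w) ⊆ pos (part w')
    ; ≤-refl  = id
    ; ≤-trans = λ f g → g ∘ f
    ; V       = λ w p → var p ∈ pos (part w)
    ; V-mono  = λ f p → f
    ; R       = λ X w v → Successor (Denotes X) (part w) (tag w) (part v)
    ; R-ext   = λ X Y X⊆Y Y⊆X u v → successor-antitone (part u)
                  (λ f w → Y⊆X w ∘ proj₁ (f w) , λ i → proj₂ (f w) i ∘ X⊆Y w)
    }

  infix 3 _⊨_
  _⊨_ : World → Fml → Set
  _⊨_ = _⊩_ model

  -- The truth lemma, by simultaneous induction on the formula. For conditionals, both halves for
  -- the antecedent are combined in `denotes` to make the constraints of `Successor` apply.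
  truth⁺ : ∀ φ w → φ ∈ pos (part w) → w ⊨ φ
  truth⁻ : ∀ φ w → φ ∈ neg (part w) → ¬ (w ⊨ φ)

  denotes : ∀ φ → Denotes (_⊨ φ) φ
  denotes φ w = truth⁺ φ w , truth⁻ φ w

  truth⁺ (var p)  w i = i
  truth⁺ ⊥'       w i = lift (proj₁ (realised (part∈ w)) i)
  truth⁺ (φ ∧ ψ)  w i with proj₁ (realised (part∈ w)) i
  ... | j , k = truth⁺ φ w j , truth⁺ ψ w k
  truth⁺ (φ ∨ ψ)  w i with proj₁ (realised (part∈ w)) i
  ... | inj₁ j = inj₁ (truth⁺ φ w j)
  ... | inj₂ k = inj₂ (truth⁺ ψ w k)
  truth⁺ (φ ⇒ ψ)  w i w' le f with proj₁ (realised (part∈ w')) (le i)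
  ... | inj₁ j = ⊥-elim (truth⁻ φ w' j f)
  ... | inj₂ k = truth⁺ ψ w' k
  truth⁺ (φ □→ ψ) w i w' v le (r , _) = truth⁺ ψ v (r (le i) (denotes φ))
  -- The witness is chosen for the tag of `w'`, so it also rejects whatever that tag forbids.
  truth⁺ (φ ◇→ ψ) w i w' le with proj₁ (realised (part∈ w')) (le i) (tag∈ w')
  ... | T' , T'∈ , succ , j =
    untagged T'∈ , successor-antitone (part w') (denotes-same (denotes φ)) succ , truth⁺ ψ (untagged T'∈) j

  truth⁻ (var p)  w i = proj₂ (realised (part∈ w)) i
  truth⁻ ⊥'       w i = lower
  truth⁻ (φ ∧ ψ)  w i (f , g) with proj₂ (realised (part∈ w)) i
  ... | inj₁ j = truth⁻ φ w j f
  ... | inj₂ k = truth⁻ ψ w k g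
  truth⁻ (φ ∨ ψ)  w i with proj₂ (realised (part∈ w)) i
  ... | j , k = [ truth⁻ φ w j , truth⁻ ψ w k ]′
  truth⁻ (φ ⇒ ψ)  w i f with proj₂ (realised (part∈ w)) i
  ... | T' , T'∈ , le , j , k =
    truth⁻ ψ (untagged T'∈) k (f (untagged T'∈) le (truth⁺ φ (untagged T'∈) j))
  truth⁻ (φ □→ ψ) w i f with proj₂ (realised (part∈ w)) i
  ... | T' , T'∈ , succ , j =
    truth⁻ ψ (untagged T'∈) j
      -- The untagged copy of `w` lies above `w`, and its dummy tag forbids nothing.
      (f (untagged (part∈ w)) (untagged T'∈) id
         (successor-antitone (part w) (denotes-same (denotes φ)) succ))
  -- In the copy of `w` tagged with the rejected formula itself, every successor for the truth set
  -- of `φ` must reject `ψ`.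
  truth⁻ (φ ◇→ ψ) w i f with f (world (part∈ w) (there i)) id
  ... | v , (_ , avoid) , g = truth⁻ ψ v (avoid refl (denotes φ)) g

-- Completeness and the equivalence

complete : ∀ φ → Valid φ → ⊢ φ
complete φ valid = conclude survivors
  where
  Sub : List Fml
  -- `⊥'` is added as the default value of `◇-target`, which `lindenbaum` must be able to place.
  Sub = ⊥' ∷ subformulas φ

  Sub-closed : Closed Sub
  Sub-closed (here refl) ()
  Sub-closed (there i) j = there (subformulas-closed φ i j)

  open Elimination Sub Sub-closed (here refl)

  conclude : (∃ λ S → AllButBad S × (∀ {T} → T ∈ S → Realised S T)) → ⊢ φ
  conclude (S , inv , realised)
    with lindenbaum inv [] (φ ∷ []) (λ ()) (λ { (here refl) → there (self∈subformulas φ) })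
  ... | inj₂ d = closed-⊢ (⋁-singleton d)
  ... | inj₁ (T , T∈S , _ , rejects) =
    ⊥-elim (truth⁻ φ (untagged T∈S) (rejects (here refl)) (valid model (untagged T∈S)))
    where open Countermodel S realised

theorem9 : (φ : Fml) → Valid φ ⟺ (⊢ φ)
theorem9 φ = record { to = complete φ ; from = λ d M → Soundness.sound M d }
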